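{- For every LTL formula $\phi$ and every finite trace $u\in\mathcal{E}^\star$, $\widehat{M}_\phi(u)=\widehat{\mathcal{M}}_{[\![\phi]\!]}(u)$, where $\widehat{M}_\phi$ is the generalised monitor synthesised from $\phi$ through nondeterministic Büchi automata for $\phi$ and $\neg\phi$, and $\widehat{\mathcal{M}}_{[\![\phi]\!]}$ is the generalised abstract monitor of the property $[\![\phi]\!]\subseteq\mathcal{E}^\omega$.
   Context: Let $\mathcal{E}$ be a finite nonempty set of events, $AP$ a set of atomic propositions and $\langle\!\langle -\rangle\!\rangle:AP\to\wp(\mathcal{E})$ an interpretation. $\mathcal{E}^\star$, $\mathcal{E}^\omega$ are the sets of finite and infinite traces. LTL formulas are built from $\top,\bot$, $p$, $p^\bot$ ($p\in AP$), $\wedge,\vee$, until $\mathcal{U}$, release $\mathcal{R}$ and next $\circ$, with the standard semantics over $w\in\mathcal{E}^\omega$ ($p$ holds at position $i$ iff $w_i\in\langle\!\langle p\rangle\!\rangle$, $p^\bot$ iff $w_i\notin\langle\!\langle p\rangle\!\rangle$); $[\![\phi]\!]\subseteq\mathcal{E}^\omega$ is the set of traces satisfying $\phi$ at position $0$. $\neg\phi$ is the negation of $\phi$, so $[\![\neg\phi]\!]=\mathcal{E}^\omega\setminus[\![\phi]\!]$. Abstract monitors. For $u\in\mathcal{E}^\star$ let $u\mathcal{E}^\omega$ be the set of infinite traces with prefix $u$. For $P\subseteq\mathcal{E}^\omega$ define $\mathcal{M}_P(u)=\mathsf{yes}$ if $u\mathcal{E}^\omega\subseteq P$, $\mathsf{no}$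 if $u\mathcal{E}^\omega\cap P=\emptyset$, $\mathsf{?}$ otherwise. $P$ is safety if every $w\notin P$ has a finite prefix $u$ with $\mathcal{M}_P(u)=\mathsf{no}$, and cosafety if every $w\in P$ has a finite prefix $u$ with $\mathcal{M}_P(u)=\mathsf{yes}$. $\Gamma_{\mathbb{S}}(P)$ is the intersection of all safety properties containing $P$, and $\Delta_{\mathsf{co}\mathbb{S}}(P)$ the union of all cosafety properties contained in $P$. Combination of verdicts. For $s,c\in\{\mathsf{yes},\mathsf{no},\mathsf{?}\}$ let $\mathrm{comb}(s,c)$ be: $\mathsf{yes}$ if $c=\mathsf{yes}$; $\mathsf{no}$ if $s=\mathsf{no}$; $\chi$ if $s=\mathsf{yes},c=\mathsf{no}$; $\mathsf{?}_{\mathsf{yes}}$ if $s=\mathsf{yes},c=\mathsf{?}$; $\mathsf{?}_{\mathsf{no}}$ if $s=\mathsf{?},c=\mathsf{no}$; $\mathsf{?}$ if $s=c=\mathsf{?}$ (no conflicting or missing case arises in the uses below). The generalised abstract monitor is $\widehat{\mathcal{M}}_P(u)=\mathrm{comb}\big(\mathcal{M}_{\Gamma_{\mathbb{S}}(P)}(u),\mathcal{M}_{\Delta_{\mathsf{co}\mathbb{S}}(P)}(u)\big)$. Synthesised monitor. For $\theta\in\{\phi,\neg\phi\}$ let $\mathcal{A}_\theta$ be a nondeterministic Büchi automaton (NBA) over the alphabet $\mathcal{E}$ accepting exactly $[\![\theta]\!]$. Let $\lceil\mathcal{A}_\theta\rceil$ be obtained from $\mathcal{A}_\theta$ by taking as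 final states exactly those states from which some infinite word is accepted by $\mathcal{A}_\theta$ (i.e. states whose accepted language is nonempty). View $\lceil\mathcal{A}_\theta\rceil$ as a nondeterministic finite automaton and let $\tilde{\mathcal{A}}_\theta$ be the complete deterministic finite automaton obtained by the subset construction. Define $M_{\tilde{\mathcal{A}}_\theta}(u)$ from the state $q$ reached by $\tilde{\mathcal{A}}_\theta$ on $u$: $\mathsf{yes}$ if all states reachable from $q$ (including $q$) are final; $\mathsf{no}$ if no state reachable from $q$ (including $q$) is final; $\mathsf{?}$ otherwise. With $\overline{\mathsf{yes}}=\mathsf{no}$, $\overline{\mathsf{no}}=\mathsf{yes}$, $\overline{\mathsf{?}}=\mathsf{?}$, set $\widehat{M}_\phi(u)=\mathrm{comb}\big(M_{\tilde{\mathcal{A}}_\phi}(u),\overline{M_{\tilde{\mathcal{A}}_{\neg\phi}}(u)}\big)$. -}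

module Defs where

open import Axiom.ExcludedMiddle using (ExcludedMiddle)
open import Data.Bool.Base using (Bool; if_then_else_)
open import Data.Empty using (⊥)
open import Data.Fin.Base using (Fin; toℕ)
open import Data.Fin.Properties using (1↔⊤; 2↔Bool; *↔×)
open import Data.Fin.Subset using (Subset; ⋃; Nonempty)
  renaming (_∈_ to _∈ˢ_; _∩_ to _∩ˢ_)
open import Data.Fin.Subset.Properties using (_∈?_)
open import Data.List.Base using (List; length; lookup; foldl; map; filter; allFin)
open import Data.Nat.Base using (ℕ; zero; suc; _≤_; _<_; _^_)
open import Data.Product.Base using (∃; _×_; _,_; uncurry)
open import Data.Product.Function.NonDependent.Propositional using (_×-↔_)
open import Data.Sum.Base using (_⊎_)
open import Data.Unit.Base using (⊤; tt)
open import Data.Vec.Base using (Vec; []; _∷_; tabulate)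
open import Function.Bundles using (_↔_; mk↔ₛ′)
open import Function.Construct.Composition using (_↔-∘_)
open import Function.Construct.Symmetry using (↔-sym)
open import Level using (Level; 0ℓ) renaming (suc to lsuc)
open import Relation.Binary.PropositionalEquality using (_≡_; refl)
open import Relation.Nullary using (does)
open import Relation.Unary using (Pred; _∈_; _∉_; _⊆_; _∩_; Empty)

private
  variable
    ℓ : Level
    E AP : Set

Trace : Set → Set
Trace E = ℕ → E

Property : Set → Set₁
Property E = Pred (Trace E) 0ℓ

Prefix : List E → Trace E → Set
Prefix u w = ∀ (i : Fin (length u)) → lookup u i ≡ w (toℕ i)

cylinder : List E → Property E
cylinder u w = Prefix u w

infixr 7 _∧_
infixr 6 _∨_
infixr 8 _𝓤_ _𝓡_
infix  9 ◯_ _^⊥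

data LTL (AP : Set) : Set where
  true false      : LTL AP
  atom _^⊥        : AP → LTL AP
  _∧_ _∨_ _𝓤_ _𝓡_ : LTL AP → LTL AP → LTL AP
  ◯_              : LTL AP → LTL AP

-- Formulas are in negation normal form, so negation is a defined operation.
neg : LTL AP → LTL AP
neg true     = false
neg false    = true
neg (atom p) = p ^⊥
neg (p ^⊥)   = atom p
neg (φ ∧ ψ)  = neg φ ∨ neg ψ
neg (φ ∨ ψ)  = neg φ ∧ neg ψ
neg (φ 𝓤 ψ)  = neg φ 𝓡 neg ψ
neg (φ 𝓡 ψ)  = neg φ 𝓤 neg ψ
neg (◯ φ)    = ◯ neg φ

Interpretation : Set → Set → Set₁
Interpretation E AP = AP → Pred E 0ℓ

module _ (⟪_⟫ : Interpretation E AP) where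

  Holds : Trace E → ℕ → LTL AP → Set
  Holds w i true     = ⊤
  Holds w i false    = ⊥
  Holds w i (atom p) = w i ∈ ⟪ p ⟫
  Holds w i (p ^⊥)   = w i ∉ ⟪ p ⟫
  Holds w i (φ ∧ ψ)  = Holds w i φ × Holds w i ψ
  Holds w i (φ ∨ ψ)  = Holds w i φ ⊎ Holds w i ψ
  Holds w i (φ 𝓤 ψ)  =
    ∃ λ j → i ≤ j × Holds w j ψ × (∀ k → i ≤ k → k < j → Holds w k φ)
  Holds w i (φ 𝓡 ψ)  =
    ∀ j → i ≤ j → Holds w j ψ ⊎ (∃ λ k → i ≤ k × k < j × Holds w k φ)
  Holds w i (◯ φ)    = Holds w (suc i) φ

  ⟦_⟧ : LTL AP → Property E
  ⟦ φ ⟧ w = Holds w 0 φ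

data Verdict : Set where
  yes no unk : Verdict

-- unk-yes and unk-no are the verdicts ?_yes and ?_no.
data Verdict⁺ : Set where
  yes no χ unk-yes unk-no unk : Verdict⁺

-- The conflicting pair (no , yes) is given the value yes.  Over a nonempty
-- alphabet it never arises from a property between its cosafety interior and
-- its safety closure.
comb : Verdict → Verdict → Verdict⁺
comb _   yes = yes
comb no  no  = no
comb no  unk = no
comb yes no  = χ
comb yes unk = unk-yes
comb unk no  = unk-no
comb unk unk = unk

flip-verdict : Verdict → Verdict
flip-verdict yes = no
flip-verdict no  = yes
flip-verdict unk = unk

-- The alphabet is E.  The same data are read as a Büchi automaton or as an
-- automaton on finite words.
record NBA (E : Set) : Set where
  field
    size    : ℕ
    initial : Subset size
    δ       : Fin size → E → Subset size
    final   : Subset size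

  State : Set
  State = Fin size

  IsRun : State → Trace E → (ℕ → State) → Set
  IsRun q w ρ = ρ 0 ≡ q × (∀ i → ρ (suc i) ∈ˢ δ (ρ i) (w i))

  AcceptsFrom : State → Property E
  AcceptsFrom q w =
    ∃ λ ρ → IsRun q w ρ × (∀ i → ∃ λ j → i ≤ j × ρ j ∈ˢ final)

  Language : Property E
  Language w = ∃ λ q → q ∈ˢ initial × AcceptsFrom q w

-- Complete deterministic finite automata.
record DFA (E : Set) : Set₁ where
  field
    State  : Set
    card   : ℕ
    finite : State ↔ Fin card
    start  : State
    step   : State → E → State
    Final  : Pred State 0ℓ

  run : State → List E → State
  run = foldl step

  Reachable : State → State → Set
  Reachable q q′ = ∃ λ v → run q v ≡ q′

Subset↔Fin : ∀ n → Subset n ↔ Fin (2 ^ n)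
Subset↔Fin zero    = ↔-sym 1↔⊤ ↔-∘ mk↔ₛ′ (λ _ → tt) (λ _ → []) (λ _ → refl) λ { [] → refl }
Subset↔Fin (suc n) =
  ↔-sym *↔× ↔-∘ ((↔-sym 2↔Bool ×-↔ Subset↔Fin n) ↔-∘ uncons↔)
  where
  uncons↔ : Vec Bool (suc n) ↔ (Bool × Vec Bool n)
  uncons↔ = mk↔ₛ′ (λ { (b ∷ bs) → b , bs }) (uncurry _∷_)
                  (λ _ → refl) (λ { (_ ∷ _) → refl })

determinise : NBA E → DFA E
determinise A = record
  { State  = Subset size
  ; card   = 2 ^ size
  ; finite = Subset↔Fin size
  ; start  = initial
  ; step   = λ S e → ⋃ (map (λ q → δ q e) (filter (_∈? S) (allFin size)))
  ; Final  = λ S → Nonempty (S ∩ˢ final)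
  }
  where open NBA A

-- Excluded middle makes the case distinctions defining the verdicts, which
-- concern arbitrary properties, into functions.
module _ (em : ∀ {ℓ} → ExcludedMiddle ℓ) where

  holds? : Set ℓ → Bool
  holds? P = does (em {P = P})

  𝓜 : Pred (Trace E) ℓ → List E → Verdict
  𝓜 P u = if holds? (cylinder u ⊆ P) then yes
          else if holds? (Empty (cylinder u ∩ P)) then no
          else unk

  Safety : Property E → Set
  Safety P = ∀ w → w ∉ P → ∃ λ u → Prefix u w × 𝓜 P u ≡ no

  Cosafety : Property E → Set
  Cosafety P = ∀ w → w ∈ P → ∃ λ u → Prefix u w × 𝓜 P u ≡ yes

  -- Quantifying over properties at level 0 loses nothing: under excluded
  -- middle every predicate is equivalent to a Boolean-valued one.
  Γ : Property E → Pred (Trace E) (lsuc 0ℓ)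
  Γ P w = ∀ Q → Safety Q → P ⊆ Q → w ∈ Q

  Δ : Property E → Pred (Trace E) (lsuc 0ℓ)
  Δ P w = ∃ λ Q → Cosafety Q × Q ⊆ P × w ∈ Q

  abstractMonitor : Property E → List E → Verdict⁺
  abstractMonitor P u = comb (𝓜 (Γ P) u) (𝓜 (Δ P) u)

  ⌈_⌉ : NBA E → NBA E
  ⌈ A ⌉ = record A
    { final = tabulate λ q → holds? (∃ λ w → w ∈ NBA.AcceptsFrom A q) }

  M : DFA E → List E → Verdict
  M D u = if holds? (∀ q′ → Reachable q q′ → q′ ∈ Final) then yes
          else if holds? (∀ q′ → Reachable q q′ → q′ ∉ Final) then no
          else unk
    where
    open DFA D
    q = run start u

  -- The first automaton is for the formula, the second for its negation.
  synthesisedMonitor : NBA E → NBA E → List E → Verdict⁺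
  synthesisedMonitor A A¬ u =
    comb (M (determinise ⌈ A ⌉) u) (flip-verdict (M (determinise ⌈ A¬ ⌉) u))

{-# OPTIONS --safe #-}

-- Call a finite trace live for P if some trace in P extends it.  A safety
-- property is left only through a non-live prefix, so Γ P consists of the
-- traces all of whose prefixes are live.  The subset automaton of ⌈ A ⌉ is in
-- a final state after u exactly when u is live for the language of A, so its
-- monitor gives the verdicts of Γ.  Complementation exchanges safety with
-- cosafety and yes with no, hence Δ P is the complement of Γ (∁ P), and the
-- automaton for the negated formula gives the flipped verdicts of Δ.
module Submission where

open import Defs
open import Axiom.ExcludedMiddle using (ExcludedMiddle)
open import Data.Bool.Base using (Bool; if_then_else_)
open import Data.Fin.Base using (Fin; zero; suc)
open import Data.Fin.Subset using (Subset; ⋃) renaming (_∈_ to _∈ˢ_)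
open import Data.Fin.Subset.Properties
  using (_∈?_; ∉⊥; x∈p∩q⁺; x∈p∩q⁻; x∈p∪q⁺; x∈p∪q⁻)
open import Data.List.Base using (List; []; _∷_; _++_; foldr; map; filter; allFin)
open import Data.List.Membership.Propositional.Properties
  using (∈-filter⁺; ∈-filter⁻; ∈-allFin)
open import Data.List.Properties using (foldl-++; ++-identityʳ)
open import Data.List.Relation.Unary.Any using (Any; here; there)
open import Data.List.Relation.Unary.Any.Properties using (map⁺; map⁻)
import Data.List.Membership.Propositional as List
open import Data.Nat.Base using (ℕ; zero; suc; s≤s⁻¹)
open import Data.Nat.Properties using (m≤n⇒m≤1+n)
open import Data.Product.Base using (∃; _×_; _,_; proj₁; proj₂)
open import Data.Sum.Base using (_⊎_; inj₁; inj₂; [_,_]′)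
import Data.Sum.Base as Sum
open import Data.Unit.Base using (tt)
open import Data.Vec.Properties using (lookup∘tabulate; []=⇒lookup; lookup⇒[]=)
open import Function.Base using (_∘_; const)
open import Function.Bundles using (_⇔_; mk⇔; _↔_; Equivalence; Inverse)
open import Function.Construct.Composition using (_⇔-∘_)
open import Function.Construct.Symmetry using (⇔-sym)
open import Level using (Level)
open import Relation.Binary.PropositionalEquality
  using (_≡_; refl; sym; trans; cong; cong₂; subst; module ≡-Reasoning)
open import Relation.Nullary using (Dec; does; ¬_; contradiction)
  renaming (yes to yes′; no to no′)
open import Relation.Nullary.Decidable using (decidable-stable; does-⇔; dec-true)
open import Relation.Unary
  using (Pred; _∈_; _⊆_; _≐_; _∩_; ∁; Empty; Satisfiable)
open import Relation.Unary.Properties using (≐-trans)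

private
  variable
    a a′ b b′ ℓ ℓ′ : Level
    E AP : Set

-- Infinite traces, their finite prefixes and liveness.

infixr 5 _∷ω_ _++ω_

_∷ω_ : E → Trace E → Trace E
(e ∷ω w) zero    = e
(e ∷ω w) (suc i) = w i

_++ω_ : List E → Trace E → Trace E
u ++ω w = foldr _∷ω_ w u

prefix-++ω : ∀ (u : List E) w → Prefix u (u ++ω w)
prefix-++ω (e ∷ u) w zero    = refl
prefix-++ω (e ∷ u) w (suc i) = prefix-++ω u w i

prefix-++⁻ˡ : ∀ (u v : List E) w → Prefix (u ++ v) w → Prefix u w
prefix-++⁻ˡ (e ∷ u) v w pre zero    = pre zero
prefix-++⁻ˡ (e ∷ u) v w pre (suc i) = prefix-++⁻ˡ u v (w ∘ suc) (pre ∘ suc) i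

prefix-comparable : ∀ (u v : List E) w → Prefix u w → Prefix v w →
                    (∃ λ x → u ++ x ≡ v) ⊎ (∃ λ x → v ++ x ≡ u)
prefix-comparable []      v       w pre pre′ = inj₁ (v , refl)
prefix-comparable (e ∷ u) []      w pre pre′ = inj₂ (e ∷ u , refl)
prefix-comparable (e ∷ u) (d ∷ v) w pre pre′ =
  Sum.map (λ (x , eq) → x , cong₂ _∷_ e≡d eq)
          (λ (x , eq) → x , cong₂ _∷_ (sym e≡d) eq)
          (prefix-comparable u v (w ∘ suc) (pre ∘ suc) (pre′ ∘ suc))
  where
  e≡d : e ≡ d
  e≡d = trans (pre zero) (sym (pre′ zero))

Live : Pred (Trace E) ℓ → List E → Set ℓ
Live P u = Satisfiable (cylinder u ∩ P)

live-++⁻ˡ : (P : Pred (Trace E) ℓ) → ∀ u v → Live P (u ++ v) → Live P u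
live-++⁻ˡ P u v (w , pre , Pw) = w , prefix-++⁻ˡ u v w pre , Pw

-- The common shape of `𝓜` and `M`: both unfold to it, so two verdicts can be compared test by test.
verdict : Bool → Bool → Verdict
verdict b c = if b then yes else if c then no else unk

-- The first test takes precedence, so exchanging the tests flips the verdict only because they
-- cannot both succeed.
verdict-swap : {A : Set a} {B : Set b} (A? : Dec A) (B? : Dec B) → ¬ (A × B) →
               verdict (does B?) (does A?) ≡ flip-verdict (verdict (does A?) (does B?))
verdict-swap (yes′ p) (yes′ q) ¬both = contradiction (p , q) ¬both
verdict-swap (yes′ p) (no′ ¬q) ¬both = refl
verdict-swap (no′ ¬p) (yes′ q) ¬both = refl
verdict-swap (no′ ¬p) (no′ ¬q) ¬both = refl

-- Transitions of the subset construction and shifts of Büchi runs.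

∈-⋃⁺ : ∀ {n} {x : Fin n} {ps : List (Subset n)} → Any (x ∈ˢ_) ps → x ∈ˢ ⋃ ps
∈-⋃⁺ (here x∈p)   = x∈p∪q⁺ (inj₁ x∈p)
∈-⋃⁺ (there x∈ps) = x∈p∪q⁺ (inj₂ (∈-⋃⁺ x∈ps))

∈-⋃⁻ : ∀ {n} {x : Fin n} (ps : List (Subset n)) → x ∈ˢ ⋃ ps → Any (x ∈ˢ_) ps
∈-⋃⁻ []       x∈⊥  = contradiction x∈⊥ ∉⊥
∈-⋃⁻ (p ∷ ps) x∈ps = [ here , there ∘ ∈-⋃⁻ ps ]′ (x∈p∪q⁻ p (⋃ ps) x∈ps)

module _ (A : NBA E) where
  open NBA A

  ∈-step⁺ : ∀ {S e p q} → p ∈ˢ S → q ∈ˢ δ p e → q ∈ˢ DFA.step (determinise A) S e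
  ∈-step⁺ {S} {p = p} p∈S q∈δ =
    ∈-⋃⁺ (map⁺ (List.lose (∈-filter⁺ (_∈? S) (∈-allFin p) p∈S) q∈δ))

  ∈-step⁻ : ∀ S e {q} → q ∈ˢ DFA.step (determinise A) S e →
            ∃ λ p → p ∈ˢ S × q ∈ˢ δ p e
  ∈-step⁻ S e q∈ =
    let ps           = filter (_∈? S) (allFin size)
        p , p∈ , q∈δ = List.find (map⁻ (∈-⋃⁻ (map (λ p → δ p e) ps) q∈))
    in  p , proj₂ (∈-filter⁻ (_∈? S) {xs = allFin size} p∈) , q∈δ

  acceptsFrom-uncons : ∀ {p w} → AcceptsFrom p w →
                       ∃ λ q → q ∈ˢ δ p (w 0) × AcceptsFrom q (w ∘ suc)
  acceptsFrom-uncons {w = w} (ρ , (refl , ρ-step) , inf) =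
    ρ 1 , ρ-step 0 , ρ ∘ suc , (refl , ρ-step ∘ suc) , inf′
    where
    inf′ : ∀ i → ∃ λ j → _ × ρ (suc j) ∈ˢ final
    -- Asking for a final visit at or after `suc i` makes its index a successor, so it survives
    -- dropping the first state.
    inf′ i with inf (suc i)
    ... | suc j , i<j , ρj∈ = j , s≤s⁻¹ i<j , ρj∈

  acceptsFrom-cons : ∀ {p q e w} → q ∈ˢ δ p e → AcceptsFrom q w →
                     AcceptsFrom p (e ∷ω w)
  acceptsFrom-cons {p} {q} {e} {w} q∈δ (ρ , (refl , ρ-step) , inf) =
    p ∷ω ρ , (refl , ρ-step′) , λ i → suc (proj₁ (inf i)) ,
      m≤n⇒m≤1+n (proj₁ (proj₂ (inf i))) , proj₂ (proj₂ (inf i))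
    where
    ρ-step′ : ∀ i → ρ i ∈ˢ δ ((p ∷ω ρ) i) ((e ∷ω w) i)
    ρ-step′ zero    = q∈δ
    ρ-step′ (suc i) = ρ-step i

-- Invariance of verdicts and closures under equivalence.

module _ (em : ∀ {ℓ} → ExcludedMiddle ℓ) where

  dne : {A : Set a} → ¬ ¬ A → A
  dne = decidable-stable em

  verdict-cong : {A : Set a} {A′ : Set a′} {B : Set b} {B′ : Set b′} → A ⇔ A′ → B ⇔ B′ →
                 verdict (holds? em A) (holds? em B) ≡
                 verdict (holds? em A′) (holds? em B′)
  verdict-cong A⇔A′ B⇔B′ = cong₂ verdict (does-⇔ A⇔A′ em em) (does-⇔ B⇔B′ em em)

  -- The levels are independent because `Γ` and `Δ` quantify over properties and so lie one universe
  -- above `closure`.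
  𝓜-cong : {P : Pred (Trace E) ℓ} {Q : Pred (Trace E) ℓ′} → P ≐ Q →
           ∀ u → 𝓜 em P u ≡ 𝓜 em Q u
  𝓜-cong (P⊆Q , Q⊆P) u = verdict-cong
    (mk⇔ (λ h {w} pre → P⊆Q (h pre)) (λ h {w} pre → Q⊆P (h pre)))
    (mk⇔ (λ h w (pre , Qw) → h w (pre , Q⊆P Qw))
         (λ h w (pre , Pw) → h w (pre , P⊆Q Pw)))

  Γ-mono : {P Q : Property E} → P ⊆ Q → Γ em P ⊆ Γ em Q
  Γ-mono P⊆Q Γw R safe Q⊆R = Γw R safe (Q⊆R ∘ P⊆Q)

  Γ-cong : {P Q : Property E} → P ≐ Q → Γ em P ≐ Γ em Q
  Γ-cong {P = P} {Q} (P⊆Q , Q⊆P) = Γ-mono {P = P} {Q} P⊆Q , Γ-mono {P = Q} {P} Q⊆P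

  -- Final subsets and live prefixes.

  module _ (A : NBA E) where
    open NBA A
    open DFA (determinise (⌈ em ⌉ A)) using (run; Final)

    final⁺ : ∀ {q w} → AcceptsFrom q w → q ∈ˢ NBA.final (⌈ em ⌉ A)
    final⁺ {q} {w} acc =
      lookup⇒[]= q _ (trans (lookup∘tabulate _ q) (dec-true em (w , acc)))

    final⁻ : ∀ {q} → q ∈ˢ NBA.final (⌈ em ⌉ A) → ∃ λ w → AcceptsFrom q w
    final⁻ {q} q∈ with em {P = ∃ (AcceptsFrom q)}
                     | trans (sym (lookup∘tabulate _ q)) ([]=⇒lookup q∈)
    ... | yes′ acc | _ = acc

    -- Reading a letter replaces the start set, so the induction on `u` needs an arbitrary `S`. For
    -- empty `u`, a final state of `⌈ A ⌉` supplies an accepted trace; longer words prepend a letter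
    -- to the run, as `⌈ A ⌉` and `A` share `δ`.
    run-final⇔ : ∀ u S → Final (run S u) ⇔
                         Live (λ w → ∃ λ q → q ∈ˢ S × AcceptsFrom q w) u
    run-final⇔ u S = mk⇔ (to u S) (λ (w , live) → from u S w live)
      where
      to : ∀ u S → Final (run S u) →
           Live (λ w → ∃ λ q → q ∈ˢ S × AcceptsFrom q w) u
      to [] S (q , q∈) =
        let q∈S , q∈F = x∈p∩q⁻ S _ q∈
            w , acc   = final⁻ q∈F
        in  w , (λ ()) , q , q∈S , acc
      to (e ∷ u) S fin =
        let w , pre , q , q∈ , acc = to u _ fin
            p , p∈S , q∈δ          = ∈-step⁻ (⌈ em ⌉ A) S e q∈
        in  e ∷ω w , (λ { zero → refl ; (suc i) → pre i }) ,
            p , p∈S , acceptsFrom-cons A q∈δ acc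

      from : ∀ u S w → w ∈ cylinder u ∩ (λ w → ∃ λ q → q ∈ˢ S × AcceptsFrom q w) →
             Final (run S u)
      from []      S w (pre , q , q∈S , acc) = q , x∈p∩q⁺ (q∈S , final⁺ acc)
      from (e ∷ u) S w (pre , p , p∈S , acc) =
        let q , q∈δ , acc′ = acceptsFrom-uncons A acc
            q∈δ′           = subst (λ d → q ∈ˢ δ p d) (sym (pre zero)) q∈δ
        in  from u _ (w ∘ suc)
              (pre ∘ suc , q , ∈-step⁺ (⌈ em ⌉ A) p∈S q∈δ′ , acc′)

  -- Safety closure and cosafety interior over a nonempty alphabet.

  module _ (e₀ : E) where

    -- Padding with a fixed letter shows that every cylinder is inhabited, hence that the tests for
    -- `yes` and `no` exclude each other.
    extend : List E → Trace E
    extend u = u ++ω const e₀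

    prefix-extend : ∀ u → Prefix u (extend u)
    prefix-extend u = prefix-++ω u (const e₀)

    𝓜-∁ : (P : Pred (Trace E) ℓ) → ∀ u → 𝓜 em (∁ P) u ≡ flip-verdict (𝓜 em P u)
    𝓜-∁ P u = trans
      (verdict-cong {A′ = Empty (cylinder u ∩ P)} {B′ = cylinder u ⊆ P}
        (mk⇔ (λ h w (pre , Pw) → h pre Pw) (λ h {w} pre Pw → h w (pre , Pw)))
        (mk⇔ (λ h {w} pre → dne λ ¬Pw → h w (pre , ¬Pw))
             (λ h w (pre , ¬Pw) → ¬Pw (h pre))))
      (verdict-swap em em λ (all , none) →
        none (extend u) (prefix-extend u , all (prefix-extend u)))

    𝓜≡no⁺ : (P : Pred (Trace E) ℓ) → ∀ u → ¬ Live P u → 𝓜 em P u ≡ no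
    𝓜≡no⁺ P u ¬live with em {P = cylinder u ⊆ P} | em {P = Empty (cylinder u ∩ P)}
    ... | yes′ all | _        =
      contradiction (extend u , prefix-extend u , all (prefix-extend u)) ¬live
    ... | no′ _    | yes′ _    = refl
    ... | no′ _    | no′ ¬none = contradiction (λ w Pw → ¬live (w , Pw)) ¬none

    𝓜≡no⁻ : (P : Pred (Trace E) ℓ) → ∀ u → 𝓜 em P u ≡ no → ¬ Live P u
    𝓜≡no⁻ P u eq (w , Pw) with em {P = cylinder u ⊆ P} | em {P = Empty (cylinder u ∩ P)}
    -- In the other cases the verdict is `yes` or `unk`, and `eq` is absurd.
    𝓜≡no⁻ P u eq (w , Pw) | no′ _ | yes′ none = none w Pw

    safety⇒cosafety : (P : Property E) → Safety em P → Cosafety em (∁ P)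
    safety⇒cosafety P safe w ¬Pw =
      let u , pre , eq = safe w ¬Pw
      in  u , pre , trans (𝓜-∁ P u) (cong flip-verdict eq)

    cosafety⇒safety : (P : Property E) → Cosafety em P → Safety em (∁ P)
    cosafety⇒safety P cosafe w ¬¬Pw =
      let u , pre , eq = cosafe w (dne ¬¬Pw)
      in  u , pre , trans (𝓜-∁ P u) (cong flip-verdict eq)

    -- Complementation matches the cosafety properties inside `P` with the safety properties
    -- containing `∁ P`, turning a union into the complement of an intersection.
    Δ≐∁Γ∁ : (P : Property E) → Δ em P ≐ ∁ (Γ em (∁ P))
    Δ≐∁Γ∁ P =
      (λ (Q , cosafe , Q⊆P , Qw) Γw →
        Γw (∁ Q) (cosafety⇒safety Q cosafe) (λ ¬Pw → ¬Pw ∘ Q⊆P) Qw) ,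
      (λ ¬Γw → dne λ ¬Δw → ¬Γw λ Q safe ∁P⊆Q → dne λ ¬Qw →
        ¬Δw (∁ Q , safety⇒cosafety Q safe , (λ {v} ¬Qv → dne (¬Qv ∘ ∁P⊆Q)) , ¬Qw))

    -- The topological closure of `P` for the topology generated by cylinders.
    closure : Property E → Property E
    closure P w = ∀ u → Prefix u w → Live P u

    -- A trace of the closure through `u` would itself witness that `u` is live, so a prefix that is
    -- not live for `P` is not live for the closure either.
    closure-safety : (P : Property E) → Safety em (closure P)
    closure-safety P w w∉ =
      let u , pre , ¬live = dne λ ∄ → w∉ λ u pre → dne λ ¬live → ∄ (u , pre , ¬live)
      in  u , pre , 𝓜≡no⁺ (closure P) u (λ (v , pre′ , v∈) → ¬live (v∈ u pre′))

    -- The closure is one of the intersected safety properties. Conversely, a trace outside a safety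
    -- `Q` containing `P` has a prefix that no trace of `Q` extends, whereas membership in the
    -- closure gives a trace of `P` extending it.
    Γ≐closure : (P : Property E) → Γ em P ≐ closure P
    Γ≐closure P =
      (λ Γw → Γw (closure P) (closure-safety P) (λ {w} Pw u pre → w , pre , Pw)) ,
      (λ {w} w∈ Q safe P⊆Q → dne λ ¬Qw →
        let u , pre , eq  = safe w ¬Qw
            v , pre′ , Pv = w∈ u pre
        in  𝓜≡no⁻ Q u eq (v , pre′ , P⊆Q Pv))

    cylinder⊆closure⇔ : (P : Property E) → ∀ u →
                        cylinder u ⊆ closure P ⇔ (∀ v → Live P (u ++ v))
    cylinder⊆closure⇔ P u = mk⇔
      (λ h v → let w = extend (u ++ v) ; pre = prefix-extend (u ++ v)
               in  h {w} (prefix-++⁻ˡ u v w pre) (u ++ v) pre)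
      (λ h {w} pre v pre′ → from h v (prefix-comparable u v w pre pre′))
      where
      from : (∀ v → Live P (u ++ v)) → ∀ v →
             (∃ λ x → u ++ x ≡ v) ⊎ (∃ λ x → v ++ x ≡ u) → Live P v
      from h v (inj₁ (x , refl)) = h x
      -- Here `v` is a prefix of `u`, and inherits liveness from `u ++ []`.
      from h v (inj₂ (x , refl)) = live-++⁻ˡ P v x (live-++⁻ˡ P (v ++ x) [] (h []))

    -- Both sides amount to `u` not being live; the quantifier over `v` matches the reachable states
    -- in `M`.
    cylinder∩closure-empty⇔ : (P : Property E) → ∀ u →
      Empty (cylinder u ∩ closure P) ⇔ (∀ v → ¬ Live P (u ++ v))
    cylinder∩closure-empty⇔ P u = mk⇔
      (λ h v (w , pre , Pw) →
        h w (prefix-++⁻ˡ u v w pre , λ x pre′ → w , pre′ , Pw))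
      (λ h w (pre , w∈) →
        h [] (subst (Live P) (sym (++-identityʳ u)) (w∈ u pre)))

    -- The states reachable after `u` are those reached on the words `u ++ v`, and such a state is
    -- final exactly when `u ++ v` is live. Both tests of `M` thus become the liveness conditions
    -- for cylinders and `closure`.
    M≡𝓜Γ : (A : NBA E) → ∀ u →
           M em (determinise (⌈ em ⌉ A)) u ≡ 𝓜 em (Γ em (NBA.Language A)) u
    M≡𝓜Γ A u = trans
      (verdict-cong
        (⇔-sym (cylinder⊆closure⇔ L u) ⇔-∘ mk⇔
          (λ h v → Equivalence.to (live⇔ v) (h _ (v , refl)))
          (λ { h _ (v , refl) → Equivalence.from (live⇔ v) (h v) }))
        (⇔-sym (cylinder∩closure-empty⇔ L u) ⇔-∘ mk⇔
          (λ h v → h _ (v , refl) ∘ Equivalence.from (live⇔ v))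
          (λ { h _ (v , refl) → h v ∘ Equivalence.to (live⇔ v) })))
      (sym (𝓜-cong (Γ≐closure L) u))
      where
      L = NBA.Language A
      open DFA (determinise (⌈ em ⌉ A)) using (run; start; step; Final)

      live⇔ : ∀ v → Final (run (run start u) v) ⇔ Live L (u ++ v)
      live⇔ v = subst (λ S → Final S ⇔ Live L (u ++ v))
                      (foldl-++ step start u v) (run-final⇔ A (u ++ v) start)

  -- Semantics of negated LTL formulas.

  module _ (⟪_⟫ : Interpretation E AP) (w : Trace E) where

    private
      _⊨_ : ℕ → LTL AP → Set
      i ⊨ φ = Holds ⟪_⟫ w i φ

    neg-sound : ∀ φ i → i ⊨ neg φ → ¬ i ⊨ φ
    neg-sound false    i _  ()
    neg-sound (atom p) i ¬h h = ¬h h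
    neg-sound (p ^⊥)   i h ¬h = ¬h h
    neg-sound (φ ∧ ψ)  i (inj₁ ¬h) (h , _) = neg-sound φ i ¬h h
    neg-sound (φ ∧ ψ)  i (inj₂ ¬h) (_ , h) = neg-sound ψ i ¬h h
    neg-sound (φ ∨ ψ)  i (¬h , _) (inj₁ h) = neg-sound φ i ¬h h
    neg-sound (φ ∨ ψ)  i (_ , ¬h) (inj₂ h) = neg-sound ψ i ¬h h
    neg-sound (φ 𝓤 ψ)  i r (j , i≤j , hψ , hφ) with r j i≤j
    ... | inj₁ ¬h                   = neg-sound ψ j ¬h hψ
    ... | inj₂ (k , i≤k , k<j , ¬h) = neg-sound φ k ¬h (hφ k i≤k k<j)
    neg-sound (φ 𝓡 ψ)  i (j , i≤j , ¬hψ , ¬hφ) r with r j i≤j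
    ... | inj₁ h                   = neg-sound ψ j ¬hψ h
    ... | inj₂ (k , i≤k , k<j , h) = neg-sound φ k (¬hφ k i≤k k<j) h
    neg-sound (◯ φ)    i = neg-sound φ (suc i)

    neg-complete : ∀ φ i → ¬ i ⊨ φ → i ⊨ neg φ
    neg-complete true     i ¬h = ¬h tt
    neg-complete false    i ¬h = tt
    neg-complete (atom p) i ¬h = ¬h
    neg-complete (p ^⊥)   i ¬h = dne ¬h
    neg-complete (φ ∧ ψ)  i ¬h with em {P = i ⊨ φ}
    ... | yes′ h  = inj₂ (neg-complete ψ i (λ h′ → ¬h (h , h′)))
    ... | no′ ¬h′ = inj₁ (neg-complete φ i ¬h′)
    neg-complete (φ ∨ ψ)  i ¬h =
      neg-complete φ i (¬h ∘ inj₁) , neg-complete ψ i (¬h ∘ inj₂)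
    -- If `ψ` holds at `j`, then `φ` must fail somewhere in between, or `j` would witness the until.
    neg-complete (φ 𝓤 ψ)  i ¬h j i≤j with em {P = j ⊨ ψ}
    ... | no′ ¬hψ = inj₁ (neg-complete ψ j ¬hψ)
    ... | yes′ hψ = inj₂ (dne λ ∄ → ¬h (j , i≤j , hψ , λ k i≤k k<j →
      dne λ ¬hφ → ∄ (k , i≤k , k<j , neg-complete φ k ¬hφ)))
    neg-complete (φ 𝓡 ψ)  i ¬h = dne λ ∄ → ¬h λ j i≤j → dne λ ¬r →
      ∄ (j , i≤j , neg-complete ψ j (¬r ∘ inj₁) , λ k i≤k k<j →
        neg-complete φ k λ h → ¬r (inj₂ (k , i≤k , k<j , h)))
    neg-complete (◯ φ)    i ¬h = neg-complete φ (suc i) ¬h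

  ⟦neg⟧≐∁⟦⟧ : (⟪_⟫ : Interpretation E AP) (φ : LTL AP) →
              ⟦_⟧ ⟪_⟫ (neg φ) ≐ ∁ (⟦_⟧ ⟪_⟫ φ)
  ⟦neg⟧≐∁⟦⟧ ⟪_⟫ φ =
    (λ {w} → neg-sound ⟪_⟫ w φ 0) , (λ {w} → neg-complete ⟪_⟫ w φ 0)

-- Equality of the synthesised and abstract monitors.

theorem3 : (em : ∀ {ℓ} → ExcludedMiddle ℓ)
    {E AP : Set} {k : ℕ} → E ↔ Fin (suc k) →
    (⟪_⟫ : Interpretation E AP) (φ : LTL AP)
    (A A¬ : NBA E) →
    NBA.Language A ≐ ⟦_⟧ ⟪_⟫ φ →
    NBA.Language A¬ ≐ ⟦_⟧ ⟪_⟫ (neg φ) →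
    (u : List E) →
    synthesisedMonitor em A A¬ u ≡ abstractMonitor em (⟦_⟧ ⟪_⟫ φ) u
theorem3 em {E} E↔Fin ⟪_⟫ φ A A¬ L≐⟦φ⟧ L¬≐⟦negφ⟧ u = cong₂ comb safety-part cosafety-part
  where
  open ≡-Reasoning

  e₀ : E
  -- The size `suc k` of the alphabet provides a letter.
  e₀ = Inverse.from E↔Fin zero

  P : Property E
  P = ⟦_⟧ ⟪_⟫ φ

  L¬≐∁P : NBA.Language A¬ ≐ ∁ P
  L¬≐∁P = ≐-trans L¬≐⟦negφ⟧ (⟦neg⟧≐∁⟦⟧ em ⟪_⟫ φ)

  safety-part : M em (determinise (⌈ em ⌉ A)) u ≡ 𝓜 em (Γ em P) u
  safety-part = begin
    M em (determinise (⌈ em ⌉ A)) u  ≡⟨ M≡𝓜Γ em e₀ A u ⟩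
    𝓜 em (Γ em (NBA.Language A)) u  ≡⟨ 𝓜-cong em (Γ-cong em L≐⟦φ⟧) u ⟩
    𝓜 em (Γ em P) u                 ∎

  cosafety-part : flip-verdict (M em (determinise (⌈ em ⌉ A¬)) u) ≡ 𝓜 em (Δ em P) u
  cosafety-part = begin
    flip-verdict (M em (determinise (⌈ em ⌉ A¬)) u)
      ≡⟨ cong flip-verdict (M≡𝓜Γ em e₀ A¬ u) ⟩
    flip-verdict (𝓜 em (Γ em (NBA.Language A¬)) u)
      ≡⟨ cong flip-verdict (𝓜-cong em (Γ-cong em L¬≐∁P) u) ⟩
    flip-verdict (𝓜 em (Γ em (∁ P)) u)
      ≡⟨ 𝓜-∁ em e₀ (Γ em (∁ P)) u ⟨
    𝓜 em (∁ (Γ em (∁ P))) u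
      ≡⟨ 𝓜-cong em (Δ≐∁Γ∁ em e₀ P) u ⟨
    𝓜 em (Δ em P) u
      ∎
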